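{- Let $h,m,n,a$ be positive integers. Then: (i) if $h>1$, \[ \frac{1}{n(n+1)(n+2)}\sum_{k=1}^{n}(-1)^{k}k^a(k+1)^a(2k+1)D_{k}^{(h)}(x)^{m}\in\mathbb{Z}[x]; \] (ii) \[ \frac{\gcd(2,m-1,n)}{n(n+1)(n+2)}\sum_{k=1}^{n}(-1)^{k}k^a(k+1)^a(2k+1)D_{k}(x)^{m}\in\mathbb{Z}[x]. \]
   Context: For $h\in\mathbb{Z}^{+}$ and $n\in\mathbb{N}$, $D_n^{(h)}(x)=\sum_{k=0}^{n}\binom{n+k}{2k}^{h}\binom{2k}{k}^{h}x^{k}$, and $D_n(x)=D_n^{(1)}(x)=\sum_{k=0}^{n}\binom{n}{k}\binom{n+k}{k}x^k$ is the Delannoy polynomial. $\gcd(2,m-1,n)$ denotes the greatest common divisor of $2$, $m-1$ and $n$. -}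

module Defs where

open import Data.Nat as ℕ using (ℕ; zero; suc)
open import Data.Nat.Combinatorics using (_C_)
open import Data.Integer as ℤ using (ℤ; +_; -[1+_])
open import Data.List using (List; []; _∷_; map; upTo)

-- Polynomials in ℤ[x] as coefficient lists (constant term first).
Poly : Set
Poly = List ℤ

infixl 6 _+ₚ_
_+ₚ_ : Poly → Poly → Poly
[] +ₚ q = q
(a ∷ p) +ₚ [] = a ∷ p
(a ∷ p) +ₚ (b ∷ q) = (a ℤ.+ b) ∷ (p +ₚ q)

infixl 7 _·ₚ_
_·ₚ_ : ℤ → Poly → Poly
c ·ₚ p = map (c ℤ.*_) p

infixl 7 _*ₚ_
_*ₚ_ : Poly → Poly → Poly
[] *ₚ q = []
(a ∷ p) *ₚ q = (a ·ₚ q) +ₚ (+ 0 ∷ (p *ₚ q))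

infixr 8 _^ₚ_
_^ₚ_ : Poly → ℕ → Poly
p ^ₚ zero = + 1 ∷ []
p ^ₚ suc m = p *ₚ (p ^ₚ m)

coeff : Poly → ℕ → ℤ
coeff [] j = + 0
coeff (a ∷ p) zero = a
coeff (a ∷ p) (suc j) = coeff p j

D : ℕ → ℕ → Poly
D h n = map (λ k → + ((((n ℕ.+ k) C (2 ℕ.* k)) ℕ.^ h) ℕ.* (((2 ℕ.* k) C k) ℕ.^ h))) (upTo (suc n))

S : ℕ → ℕ → ℕ → ℕ → Poly
S h m a zero = []
S h m a (suc n) =
  S h m a n +ₚ
  ((-[1+ 0 ] ℤ.^ suc n) ℤ.* (+ ((suc n ℕ.^ a) ℕ.* ((suc (suc n)) ℕ.^ a) ℕ.* (2 ℕ.* suc n ℕ.+ 1))))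
    ·ₚ (D h (suc n) ^ₚ m)

module Submission where

-- Let b_j(k) = C(k,j) C(k+j,j), the coefficient of x^j in D_k(x). The ℤ-span A
-- of the b_j is a ring, since
--   b_i b_j = C(i+j,i) Σ_u C(j,u) C(i+u,j) b_{i+u},
-- and b_1(k) = k(k+1). The sum Σ_{k≤n} (-1)^k (2k+1) k(k+1) b_j(k) equals
--   (-1)^n (n+1) C(n,j) C(n+j+1,j) (n(n+2) - j),
-- where n divides j C(n,j) and n+2 divides j C(n+j+1,j). As a Bézout
-- combination of n and n+2 equals gcd(2,n), this sum is divisible by
-- n(n+1)(n+2) after multiplication by gcd(2,n), and without it when j ≤ 1.
-- Hence no factor is lost when the summands lie in the subring
-- G = ℤ + ℤ b_1 + 2A. As C(2i,i) is even for i > 0, G contains every b_i^h with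
-- h > 1 and the square of each element of A; the coefficients of an even power
-- of D_k(x) are sums of such squares and of doubled products.

open import Defs
open import Data.Nat as ℕ using (ℕ; zero; suc; z≤n; s≤s; _≤_; _<_; _∸_)
import Data.Nat.Properties as ℕₚ
open import Data.Nat.Combinatorics using (_C_; nCk+nC[k+1]≡[n+1]C[k+1]; k>n⇒nCk≡0; nCn≡1; nC1≡n)
import Data.Nat.Divisibility as ℕDiv
open import Data.Nat.GCD using (gcd; gcd-greatest)
open import Data.Integer as ℤ using (ℤ; +_; -[1+_]; _+_; _*_; _-_; -_)
import Data.Integer.Divisibility as Unsigned
open import Data.Integer.Divisibility.Signed using (_∣_; divides; ∣m∣n⇒∣m+n; ∣n⇒∣m*n; ∣⇒∣ᵤ)
open import Data.Integer.Properties
  using (+-assoc; +-identityˡ; +-identityʳ; *-assoc; *-comm; *-identityˡ; *-identityʳ; *-zeroʳ;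
         *-distribˡ-+; *-cancelˡ-≡; i*j≢0; pos-*)
open import Data.Integer.Tactic.RingSolver using (solve-∀)
open import Data.List using ([]; _∷_; map; applyUpTo)
open import Data.Product using (∃-syntax; _,_; _×_)
open import Data.Sum using (_⊎_; inj₁; inj₂)
open import Function using (_∘_; id)
open import Relation.Binary.PropositionalEquality
  using (_≡_; refl; sym; trans; cong; cong₂; subst; subst₂)
open import Relation.Nullary using (yes; no)

-- Equations derived as explicit linear combinations of known ones: the last
-- hypothesis is a polynomial identity, within reach of the ring solver.
lin₁ : ∀ {x y a b} p → a ≡ b → x ≡ y + p * (a - b) → x ≡ y
lin₁ {y = y} {a} p refl x≡ = trans x≡ (cancel y p a)
  where
  cancel : ∀ y p a → y + p * (a - a) ≡ y
  cancel = solve-∀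

lin₂ : ∀ {x y a b c d} p q → a ≡ b → c ≡ d →
       x ≡ y + p * (a - b) + q * (c - d) → x ≡ y
lin₂ p q a≡b c≡d x≡ = lin₁ p a≡b (lin₁ q c≡d x≡)

lin₃ : ∀ {x y a b c d e f} p q r → a ≡ b → c ≡ d → e ≡ f →
       x ≡ y + p * (a - b) + q * (c - d) + r * (e - f) → x ≡ y
lin₃ p q r a≡b c≡d e≡f x≡ = lin₂ p q a≡b c≡d (lin₁ r e≡f x≡)

-- Binomial coefficients as integers: Pascal's rule and absorption.

binom : ℕ → ℕ → ℤ
binom n k = + (n C k)

pascal : ∀ n k → binom (suc n) (suc k) ≡ binom n k + binom n (suc k)
pascal n k = cong +_ (sym (nCk+nC[k+1]≡[n+1]C[k+1] n k))

absorb : ∀ n k → + suc k * binom (suc n) (suc k) ≡ + suc n * binom n k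
absorb zero    zero    = refl
absorb zero    (suc k) = trans
  (cong (+ suc (suc k) *_) (cong +_ (k>n⇒nCk≡0 {1} {suc (suc k)} (s≤s (s≤s z≤n)))))
  (*-zeroʳ (+ suc (suc k)))
absorb (suc n) zero    = lin₂ (+ 1) (+ 1) (pascal (suc n) 0) (absorb n 0)
  (alg (binom (suc (suc n)) 1) (binom (suc n) 1) (+ n))
  where
  alg : ∀ x y n → + 1 * x ≡ (+ 2 + n) * + 1
        + + 1 * (x - (+ 1 + y)) + + 1 * (+ 1 * y - (+ 1 + n) * + 1)
  alg = solve-∀
absorb (suc n) (suc k) = lin₂ (+ suc (suc k)) (+ 1) (pascal (suc n) (suc k)) (absorb n (suc k))
  (lin₂ (+ 1) (- (+ suc n)) (absorb n k) (pascal n k)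
    (alg (binom (suc (suc n)) (suc (suc k))) (binom (suc n) (suc k)) (binom (suc n) (suc (suc k)))
         (binom n k) (binom n (suc k)) (+ n) (+ k)))
  where
  alg : ∀ x y z u v n k → (+ 2 + k) * x ≡ (+ 2 + n) * y
        + (+ 2 + k) * (x - (y + z)) + + 1 * ((+ 2 + k) * z - (+ 1 + n) * v)
        + + 1 * ((+ 1 + k) * y - (+ 1 + n) * u) + (- (+ 1 + n)) * (y - (u + v))
  alg = solve-∀

absorb-lower : ∀ n k → + suc k * binom n (suc k) ≡ (+ n - + k) * binom n k
absorb-lower n k = lin₂ (+ 1) (- (+ suc k)) (absorb n k) (pascal n k)
  (alg (binom (suc n) (suc k)) (binom n k) (binom n (suc k)) (+ n) (+ k))
  where
  alg : ∀ x y z n k → (+ 1 + k) * z ≡ (n - k) * y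
        + + 1 * ((+ 1 + k) * x - (+ 1 + n) * y) + (- (+ 1 + k)) * (x - (y + z))
  alg = solve-∀

absorb-upper : ∀ n k → (+ suc n - + k) * binom (suc n) k ≡ + suc n * binom n k
absorb-upper n zero = alg (+ n)
  where
  alg : ∀ n → ((+ 1 + n) - + 0) * + 1 ≡ (+ 1 + n) * + 1
  alg = solve-∀
absorb-upper n (suc k) = lin₂ (- + 1) (+ suc n) (absorb n k) (pascal n k)
  (alg (binom (suc n) (suc k)) (binom n k) (binom n (suc k)) (+ n) (+ k))
  where
  alg : ∀ x y z n k → ((+ 1 + n) - (+ 1 + k)) * x ≡ (+ 1 + n) * z
        + (- + 1) * ((+ 1 + k) * x - (+ 1 + n) * y) + (+ 1 + n) * (x - (y + z))
  alg = solve-∀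

-- Induction on `y`: after multiplication by `(y+x+1)(y+1)`, absorption lowers every binomial
-- coefficient that involves `y+1`.
trinomial : ∀ m x y → binom (y ℕ.+ m) (y ℕ.+ x) * binom (y ℕ.+ x) y
                    ≡ binom m x * binom (y ℕ.+ m) y
trinomial m x zero    = refl
trinomial m x (suc y) = *-cancelˡ-≡ (+ suc (y ℕ.+ x) * + suc y) _ _ {{i*j≢0 (+ suc (y ℕ.+ x)) (+ suc y)}}
  (lin₂ (+ suc y * binom (suc (y ℕ.+ x)) (suc y)) (+ suc (y ℕ.+ m) * binom (y ℕ.+ m) (y ℕ.+ x))
        (absorb (y ℕ.+ m) (y ℕ.+ x)) (absorb (y ℕ.+ x) y)
  (lin₂ (- (+ suc (y ℕ.+ x) * binom m x)) (+ suc (y ℕ.+ m) * + suc (y ℕ.+ x))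
        (absorb (y ℕ.+ m) y) (trinomial m x y)
    (alg (binom (suc y ℕ.+ m) (suc y ℕ.+ x)) (binom (suc y ℕ.+ x) (suc y)) (binom m x)
         (binom (suc y ℕ.+ m) (suc y)) (binom (y ℕ.+ m) (y ℕ.+ x)) (binom (y ℕ.+ x) y)
         (binom (y ℕ.+ m) y) (+ y) (+ (y ℕ.+ x)) (+ (y ℕ.+ m)))))
  where
  alg : ∀ a b c d e f g y x m → (+ 1 + x) * (+ 1 + y) * (a * b) ≡ (+ 1 + x) * (+ 1 + y) * (c * d)
        + (+ 1 + y) * b * ((+ 1 + x) * a - (+ 1 + m) * e)
        + (+ 1 + m) * e * ((+ 1 + y) * b - (+ 1 + x) * f)
        + (- ((+ 1 + x) * c)) * ((+ 1 + y) * d - (+ 1 + m) * g)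
        + (+ 1 + m) * (+ 1 + x) * (e * f - c * g)
  alg = solve-∀

-- The basis functions and their recurrences.

-- By trinomial, basis j k = C(k+j,2j) C(2j,j), the coefficient of x^j in D_k(x).
basis : ℕ → ℕ → ℤ
basis j k = binom k j * binom (j ℕ.+ k) j

-- So `basis j k` is the product of `k(k+1) - i(i+1)` over `i < j`, divided by `j!²`: a polynomial
-- of degree `j` in `k(k+1)`.
basis-suc : ∀ j k → + suc j * + suc j * basis (suc j) k
                  ≡ (+ k * + suc k - + j * + suc j) * basis j k
basis-suc j k = lin₂ (+ suc j * binom (suc (j ℕ.+ k)) (suc j)) ((+ k - + j) * binom k j)
  (absorb-lower k j) (absorb (j ℕ.+ k) j)
  (alg (binom k (suc j)) (binom (suc (j ℕ.+ k)) (suc j)) (binom k j) (binom (j ℕ.+ k) j) (+ j) (+ k))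
  where
  alg : ∀ a b c d j k → (+ 1 + j) * (+ 1 + j) * (a * b) ≡ (k * (+ 1 + k) - j * (+ 1 + j)) * (c * d)
        + (+ 1 + j) * b * ((+ 1 + j) * a - (k - j) * c)
        + (k - j) * c * ((+ 1 + j) * b - (+ 1 + (j + k)) * d)
  alg = solve-∀

-- The ratio of consecutive values of `(n+j)! / ((n-j)! j!²)`, cleared of denominators so that it
-- also covers `j > n`.
basis-upper : ∀ j n → (+ suc n - + j) * basis j (suc n) ≡ + (suc j ℕ.+ n) * basis j n
basis-upper j n = *-cancelˡ-≡ (+ suc n) _ _
  (lin₂ (+ suc n * binom (j ℕ.+ suc n) j) (+ suc n * binom n j)
    (absorb-upper n j) upper
    (alg (binom (suc n) j) (binom (j ℕ.+ suc n) j) (binom n j) (binom (j ℕ.+ n) j) (+ j) (+ n)))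
  where
  upper : + suc n * binom (j ℕ.+ suc n) j ≡ + suc (j ℕ.+ n) * binom (j ℕ.+ n) j
  upper rewrite ℕₚ.+-suc j n = trans (cong (_* binom (suc (j ℕ.+ n)) j) (cancel (+ j) (+ n)))
    (absorb-upper (j ℕ.+ n) j)
    where
    cancel : ∀ j n → + 1 + n ≡ + 1 + (j + n) - j
    cancel = solve-∀
  alg : ∀ a b c d j n → (+ 1 + n) * ((+ 1 + n - j) * (a * b)) ≡ (+ 1 + n) * ((+ 1 + (j + n)) * (c * d))
        + (+ 1 + n) * b * ((+ 1 + n - j) * a - (+ 1 + n) * c)
        + (+ 1 + n) * c * ((+ 1 + n) * b - (+ 1 + (j + n)) * d)
  alg = solve-∀

-- Exposes the factor `n+1` in the closed form of `altSum (basis j) n`.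
scaled-basis : ∀ j n → + (suc j ℕ.+ n) * basis j n ≡ + suc n * (binom n j * binom (suc (j ℕ.+ n)) j)
scaled-basis j n = lin₁ (- (binom n j)) (absorb-upper (j ℕ.+ n) j)
  (alg (binom n j) (binom (j ℕ.+ n) j) (binom (suc (j ℕ.+ n)) j) (+ j) (+ n))
  where
  alg : ∀ a b c j n → (+ 1 + (j + n)) * (a * b) ≡ (+ 1 + n) * (a * c)
        + (- a) * ((+ 1 + (j + n) - j) * c - (+ 1 + (j + n)) * b)
  alg = solve-∀

-- Weighted alternating sums.

sign : ℕ → ℤ
sign n = -[1+ 0 ] ℤ.^ n

-- Contains one factor `k(k+1)`, available because the exponent `a` is positive.
weight : ℕ → ℤ
weight k = (+ 2 * + k + + 1) * (+ k * + suc k)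

altSum : (ℕ → ℤ) → ℕ → ℤ
altSum f zero    = + 0
altSum f (suc n) = altSum f n + sign (suc n) * weight (suc n) * f (suc n)

altSum-cong : ∀ {f g} → (∀ k → f k ≡ g k) → ∀ n → altSum f n ≡ altSum g n
altSum-cong f≗g zero    = refl
altSum-cong f≗g (suc n) = cong₂ (λ s v → s + sign (suc n) * weight (suc n) * v)
  (altSum-cong f≗g n) (f≗g (suc n))

altSum-+ : ∀ f g n → altSum (λ k → f k + g k) n ≡ altSum f n + altSum g n
altSum-+ f g zero    = refl
altSum-+ f g (suc n) = lin₁ (+ 1) (altSum-+ f g n)
  (alg (altSum (λ k → f k + g k) n) (altSum f n) (altSum g n)
       (sign (suc n) * weight (suc n)) (f (suc n)) (g (suc n)))
  where
  alg : ∀ r s t w x y →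
    r + w * (x + y) ≡ s + w * x + (t + w * y) + + 1 * (r - (s + t))
  alg = solve-∀

altSum-* : ∀ c f n → altSum (λ k → c * f k) n ≡ c * altSum f n
altSum-* c f zero    = sym (*-zeroʳ c)
altSum-* c f (suc n) = lin₁ (+ 1) (altSum-* c f n)
  (alg c (altSum (λ k → c * f k) n) (altSum f n) (sign (suc n) * weight (suc n)) (f (suc n)))
  where
  alg : ∀ c r s w x → r + w * (c * x) ≡ c * (s + w * x) + + 1 * (r - c * s)
  alg = solve-∀

-- Telescoping: by `basis-upper`, the closed forms at `n+1` and `n` differ by exactly the new
-- summand.
altSum-basis : ∀ j n → altSum (basis j) n
                     ≡ sign n * (+ (suc j ℕ.+ n) * basis j n * (+ n * + suc (suc n) - + j))
altSum-basis zero    zero    = refl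
altSum-basis (suc j) zero
  rewrite k>n⇒nCk≡0 {0} {suc j} (s≤s z≤n)
        | *-zeroʳ (+ (suc (suc j) ℕ.+ 0)) = refl
altSum-basis j       (suc n) = lin₂ (+ 1) (sign n * (+ n * + suc (suc n) - + j) * - (+ 1))
  (altSum-basis j n) (basis-upper j n)
  (alg (altSum (basis j) n) (sign n) (basis j n) (basis j (suc n)) (+ j) (+ n))
  where
  alg : ∀ s σ b b′ j n →
    s + (- + 1) * σ * ((+ 2 * (+ 1 + n) + + 1) * ((+ 1 + n) * (+ 2 + n))) * b′
    ≡ (- + 1) * σ * ((+ 1 + (j + (+ 1 + n))) * b′ * ((+ 1 + n) * (+ 3 + n) - j))
      + + 1 * (s - σ * ((+ 1 + (j + n)) * b * (n * (+ 2 + n) - j)))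
      + σ * (n * (+ 2 + n) - j) * (- + 1) * ((+ 1 + n - j) * b′ - (+ 1 + (j + n)) * b)
  alg = solve-∀

-- Divisibility of the sums over basis functions.

modulus : ℕ → ℤ
modulus n = + n * + suc n * + suc (suc n)

upperBinom : ℕ → ℕ → ℤ
upperBinom n j = binom (suc (j ℕ.+ n)) j

-- The closed form is, up to sign, `n+1` times `C(n,j) C(n+j+1,j) (n(n+2) - j)`. The part with
-- `n(n+2)` is divisible outright, which leaves the part with `j`.
altSum-basis-∣ : ∀ n t j → + n * + suc (suc n) ∣ t * (+ j * (binom n j * upperBinom n j)) →
                 modulus n ∣ t * altSum (basis j) n
altSum-basis-∣ n t j (divides q eq) = divides (sign n * (t * (binom n j * upperBinom n j) - q))
  (lin₃ t (t * sign n * (+ n * + suc (suc n) - + j)) (- (sign n * + suc n))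
    (altSum-basis j n) (scaled-basis j n) eq
    (alg (altSum (basis j) n) (sign n) (basis j n) (binom n j) (upperBinom n j) t q (+ j) (+ n)))
  where
  alg : ∀ s σ b l u t q j n →
    t * s ≡ σ * (t * (l * u) - q) * (n * (+ 1 + n) * (+ 2 + n))
      + t * (s - σ * ((+ 1 + (j + n)) * b * (n * (+ 2 + n) - j)))
      + t * σ * (n * (+ 2 + n) - j) * ((+ 1 + (j + n)) * b - (+ 1 + n) * (l * u))
      + (- (σ * (+ 1 + n))) * (t * (j * (l * u)) - q * (n * (+ 2 + n)))
  alg = solve-∀

n∣j*binom : ∀ n j → + suc n ∣ + j * binom (suc n) j
n∣j*binom n zero    = divides (+ 0) refl
n∣j*binom n (suc j) = divides (binom n j) (trans (absorb n j) (*-comm (+ suc n) (binom n j)))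

-- For `j > 0` the quotient is `C(n+j+1,j-1)`, since the lower absorption factor is
-- `(n+j+1) - (j-1) = n+2`.
n+2∣j*upperBinom : ∀ n j → + suc (suc n) ∣ + j * upperBinom n j
n+2∣j*upperBinom n zero    = divides (+ 0) refl
n+2∣j*upperBinom n (suc j) = divides (binom (suc (suc j ℕ.+ n)) j)
  (trans (absorb-lower (suc (suc j ℕ.+ n)) j) (alg (binom (suc (suc j ℕ.+ n)) j) (+ j) (+ n)))
  where
  alg : ∀ b j n → (+ 2 + (j + n) - j) * b ≡ b * (+ 2 + n)
  alg = solve-∀

-- With `N = n+1`, the multiple `uN` supplies `N` while `j C(N+j+1,j)` supplies `N+2`; the multiple
-- `v(N+2)` supplies `N+2` while `j C(N,j)` supplies `N`.
bezout-∣ : ∀ n {t} u v → t ≡ u * + suc n + v * + suc (suc (suc n)) → ∀ j →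
           modulus (suc n) ∣ t * altSum (basis j) (suc n)
bezout-∣ n {t} u v t≡ j with n∣j*binom n j | n+2∣j*upperBinom (suc n) j
... | divides p l≡ | divides q r≡ =
  altSum-basis-∣ N t j (divides (u * q * binom N j + v * p * upperBinom N j)
    (lin₃ (+ j * (binom N j * upperBinom N j)) (v * + suc (suc N) * upperBinom N j)
          (u * + N * binom N j) t≡ l≡ r≡
      (alg t u v (binom N j) (upperBinom N j) p q (+ j) (+ N))))
  where
  N = suc n
  alg : ∀ t u v l r p q j n →
    t * (j * (l * r)) ≡ (u * q * l + v * p * r) * (n * (+ 2 + n))
      + j * (l * r) * (t - (u * n + v * (+ 2 + n)))
      + v * (+ 2 + n) * r * (j * l - p * n)
      + u * n * l * (j * r - q * (+ 2 + n))
  alg = solve-∀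

-- A second factor `j` serves both binomial coefficients at once. At `j = 1` it costs nothing.
index-multiple-∣ : ∀ n j → modulus (suc n) ∣ + j * altSum (basis j) (suc n)
index-multiple-∣ n j with n∣j*binom n j | n+2∣j*upperBinom (suc n) j
... | divides p l≡ | divides q r≡ = altSum-basis-∣ N (+ j) j (divides (p * q)
  (lin₂ (+ j * upperBinom N j) (p * + N) l≡ r≡
    (alg (binom N j) (upperBinom N j) p q (+ j) (+ N))))
  where
  N = suc n
  alg : ∀ l r p q j n →
    j * (j * (l * r)) ≡ p * q * (n * (+ 2 + n))
      + j * r * (j * l - p * n) + p * n * (j * r - q * (+ 2 + n))
  alg = solve-∀

double-∣ : ∀ n j → modulus (suc n) ∣ + 2 * altSum (basis j) (suc n)
double-∣ n = bezout-∣ n (- + 1) (+ 1) (alg (+ suc n))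
  where
  alg : ∀ n → + 2 ≡ (- + 1) * n + + 1 * (+ 2 + n)
  alg = solve-∀

-- For odd `N = 2r+1` the numbers `N` and `N+2` are coprime: `(r+1)N - r(N+2) = 1`.
odd-basis-∣ : ∀ r j → modulus (suc (r ℕ.+ r)) ∣ + 1 * altSum (basis j) (suc (r ℕ.+ r))
odd-basis-∣ r = bezout-∣ (r ℕ.+ r) (+ suc r) (- (+ r)) (alg (+ r))
  where
  alg : ∀ r → + 1 ≡ (+ 1 + r) * (+ 1 + (r + r)) + (- r) * (+ 2 + (+ 1 + (r + r)))
  alg = solve-∀

-- The span of the scaled basis is ℤ + ℤ b₁ + 2A, where A is the span of the basis.
goodWeight : ℕ → ℤ
goodWeight 0             = + 1
goodWeight 1             = + 1
goodWeight (suc (suc _)) = + 2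

goodBasis : ℕ → ℕ → ℤ
goodBasis j k = goodWeight j * basis j k

goodBasis-∣ : ∀ n j → modulus (suc n) ∣ goodWeight j * altSum (basis j) (suc n)
goodBasis-∣ n zero = altSum-basis-∣ (suc n) (+ 1) 0 (divides (+ 0) refl)
goodBasis-∣ n (suc zero) = index-multiple-∣ n 1
goodBasis-∣ n (suc (suc j)) = double-∣ n (suc (suc j))

-- Integer spans of families of functions.

data Span (g : ℕ → ℕ → ℤ) : (ℕ → ℤ) → Set where
  gen   : ∀ j → Span g (g j)
  add   : ∀ {f f′} → Span g f → Span g f′ → Span g (λ k → f k + f′ k)
  scale : ∀ c {f} → Span g f → Span g (λ k → c * f k)
  resp  : ∀ {f f′} → (∀ k → f k ≡ f′ k) → Span g f → Span g f′

span-bind : ∀ {g h f} → (∀ j → Span h (g j)) → Span g f → Span h f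
span-bind φ (gen j)     = φ j
span-bind φ (add p q)   = add (span-bind φ p) (span-bind φ q)
span-bind φ (scale c p) = scale c (span-bind φ p)
span-bind φ (resp e p)  = resp e (span-bind φ p)

span-*ˡ : ∀ {g h} (u : ℕ → ℤ) → (∀ j → Span h (λ k → u k * g j k)) →
          ∀ {f} → Span g f → Span h (λ k → u k * f k)
span-*ˡ u φ (gen j) = φ j
span-*ˡ u φ (add {f} {f′} p q) =
  resp (λ k → sym (*-distribˡ-+ (u k) (f k) (f′ k))) (add (span-*ˡ u φ p) (span-*ˡ u φ q))
span-*ˡ u φ (scale c {f} p) = resp (λ k → alg c (u k) (f k)) (scale c (span-*ˡ u φ p))
  where
  alg : ∀ c x y → c * (x * y) ≡ x * (c * y)
  alg = solve-∀
span-*ˡ u φ (resp e p) = resp (λ k → cong (u k *_) (e k)) (span-*ˡ u φ p)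

-- Bilinearity, one factor at a time: `f` is expanded against a fixed generator, then `f′` against
-- the fixed `f`.
span-* : ∀ {g h} → (∀ i j → Span h (λ k → g i k * g j k)) →
         ∀ {f f′} → Span g f → Span g f′ → Span h (λ k → f k * f′ k)
span-* {g} {h} φ {f} p = span-*ˡ f (λ j → swap (g j) f (span-*ˡ (g j) (φ j) p))
  where
  swap : ∀ u v → Span h (λ k → u k * v k) → Span h (λ k → v k * u k)
  swap u v = resp (λ k → *-comm (u k) (v k))

-- `altSum` is linear in the function, so divisibility passes from the generators to their span.
span-∣ : ∀ {g d} t n → (∀ j → d ∣ t * altSum (g j) n) → ∀ {f} → Span g f → d ∣ t * altSum f n
span-∣ t n φ (gen j) = φ j
span-∣ {d = d} t n φ (add {f} {f′} p q) = subst (d ∣_)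
  (trans (sym (*-distribˡ-+ t _ _)) (cong (t *_) (sym (altSum-+ f f′ n))))
  (∣m∣n⇒∣m+n (span-∣ t n φ p) (span-∣ t n φ q))
span-∣ {d = d} t n φ (scale c {f} p) = subst (d ∣_)
  (trans (alg c t (altSum f n)) (cong (t *_) (sym (altSum-* c f n))))
  (∣n⇒∣m*n c (span-∣ t n φ p))
  where
  alg : ∀ c t s → c * (t * s) ≡ t * (c * s)
  alg = solve-∀
span-∣ {d = d} t n φ (resp e p) = subst (d ∣_) (cong (t *_) (altSum-cong e n)) (span-∣ t n φ p)

-- Linearisation of products of basis functions.

sumTo : (ℕ → ℤ) → ℕ → ℤ
sumTo f zero    = f 0
sumTo f (suc v) = sumTo f v + f (suc v)

linCoeff : ℕ → ℕ → ℕ → ℤ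
linCoeff i j u = binom j u * binom (u ℕ.+ i) j

linSum : ℕ → ℕ → ℕ → ℕ → ℤ
linSum i j v k = sumTo (λ u → linCoeff i j u * basis (u ℕ.+ i) k) v

-- Compares coefficients of `basis s` when the expansion for `j` is multiplied by `k(k+1) - j(j+1)`:
-- one contribution comes from `basis s` itself, the other from its predecessor.
linCoeff-suc : ∀ i j u → let s = suc (u ℕ.+ i) in
  + suc j * + suc (j ℕ.+ i) * linCoeff i (suc j) (suc u)
  ≡ (+ s * + suc s - + j * + suc j) * linCoeff i j (suc u) + + s * + s * linCoeff i j u
linCoeff-suc i j u =
  lin₂ (+ suc (j ℕ.+ i) * binom (suc j) (suc u)) (+ s * binom j u) (absorb-lower s j) (absorb-upper (u ℕ.+ i) j)
  (lin₂ (+ suc (j ℕ.+ i) * (+ s - + j) * binom s j) (- ((+ s - + j) * binom s j)) (pascal j u) (absorb-lower j u)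
  (alg (binom (suc j) (suc u)) (binom s (suc j)) (binom j (suc u)) (binom j u) (binom s j) (binom (u ℕ.+ i) j)
       (+ i) (+ j) (+ u)))
  where
  s = suc (u ℕ.+ i)
  alg : ∀ x y a b c d i j u →
    (+ 1 + j) * (+ 1 + (j + i)) * (x * y)
    ≡ ((+ 1 + (u + i)) * (+ 2 + (u + i)) - j * (+ 1 + j)) * (a * c) + (+ 1 + (u + i)) * (+ 1 + (u + i)) * (b * d)
      + (+ 1 + (j + i)) * x * ((+ 1 + j) * y - (+ 1 + (u + i) - j) * c)
      + (+ 1 + (u + i)) * b * ((+ 1 + (u + i) - j) * c - (+ 1 + (u + i)) * d)
      + (+ 1 + (j + i)) * (+ 1 + (u + i) - j) * c * (x - (b + a))
      + (- ((+ 1 + (u + i) - j) * c)) * ((+ 1 + u) * a - (j - u) * b)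
  alg = solve-∀

-- Multiplying by k(k+1) − j(j+1) sends basis j to (j+1)² basis (j+1), and
-- basis s to a combination of basis s and basis (s+1); the term carrying
-- basis (v+i+1) is what a partial sum still owes to its successor.
linSum-suc : ∀ i j k v →
  + suc j * + suc (j ℕ.+ i) * linSum i (suc j) v k
    + + suc (v ℕ.+ i) * + suc (v ℕ.+ i) * (linCoeff i j v * basis (suc v ℕ.+ i) k)
  ≡ (+ k * + suc k - + j * + suc j) * linSum i j v k
linSum-suc i j k zero = lin₂ (+ suc (j ℕ.+ i) * basis i k) (binom i j) (absorb-lower i j) (basis-suc i k)
  (alg (binom i (suc j)) (binom i j) (basis i k) (basis (suc i) k) (+ i) (+ j) (+ k))
  where
  alg : ∀ x y b b′ i j k →
    (+ 1 + j) * (+ 1 + (j + i)) * (+ 1 * x * b) + (+ 1 + i) * (+ 1 + i) * (+ 1 * y * b′)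
    ≡ (k * (+ 1 + k) - j * (+ 1 + j)) * (+ 1 * y * b)
      + (+ 1 + (j + i)) * b * ((+ 1 + j) * x - (i - j) * y)
      + y * ((+ 1 + i) * (+ 1 + i) * b′ - (k * (+ 1 + k) - i * (+ 1 + i)) * b)
  alg = solve-∀
linSum-suc i j k (suc v) =
  lin₃ (+ 1) (basis s k) (linCoeff i j (suc v)) (linSum-suc i j k v) (linCoeff-suc i j v) (basis-suc s k)
  (alg (linSum i (suc j) v k) (linSum i j v k) (linCoeff i j v) (linCoeff i j (suc v)) (linCoeff i (suc j) (suc v))
       (basis s k) (basis (suc s) k) (+ s) (+ (j ℕ.+ i)) (+ j) (+ k))
  where
  s = suc (v ℕ.+ i)
  alg : ∀ t′ t c d d′ b b′ s i j k →
    (+ 1 + j) * (+ 1 + i) * (t′ + d′ * b) + (+ 1 + s) * (+ 1 + s) * (d * b′)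
    ≡ (k * (+ 1 + k) - j * (+ 1 + j)) * (t + d * b)
      + + 1 * ((+ 1 + j) * (+ 1 + i) * t′ + s * s * (c * b) - (k * (+ 1 + k) - j * (+ 1 + j)) * t)
      + b * ((+ 1 + j) * (+ 1 + i) * d′ - ((s * (+ 1 + s) - j * (+ 1 + j)) * d + s * s * c))
      + d * ((+ 1 + s) * (+ 1 + s) * b′ - (k * (+ 1 + k) - s * (+ 1 + s)) * b)
  alg = solve-∀

-- Induction on `j`: multiplication by `k(k+1) - j(j+1)` raises `j` on both sides, and
-- `(j+i+1) C(j+i,i) = (j+1) C(j+i+1,i)` lets `(j+1)²` cancel.
basis-* : ∀ i j k → basis i k * basis j k ≡ binom (j ℕ.+ i) i * linSum i j j k
basis-* i zero k = lin₁ (- basis i k) (cong +_ (nCn≡1 i)) (alg (binom i i) (basis i k))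
  where
  alg : ∀ x b → b * + 1 ≡ x * (+ 1 * b) + (- b) * (x - + 1)
  alg = solve-∀
basis-* i (suc j) k = *-cancelˡ-≡ (+ suc j * + suc j) _ _ {{i*j≢0 (+ suc j) (+ suc j)}}
  (lin₃ (basis i k) (+ k * + suc k - + j * + suc j)
        (- B)
        (basis-suc j k) (basis-* i j k) (linSum-suc i j k (suc j))
  (lin₂ (B * (+ suc s * + suc s * (binom s j * basis (suc s) k)
          - (+ k * + suc k - + j * + suc j) * (binom s j * basis s k)))
        (- (+ suc j * linSum i (suc j) (suc j) k))
        -- As `C(j,j+1) = 0`, extending the sum for `j` to index `j+1` adds nothing, and the term
        -- owed to a successor vanishes.
        (cong +_ (k>n⇒nCk≡0 {j} {suc j} ℕₚ.≤-refl)) (absorb-upper (j ℕ.+ i) i)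
  (alg (basis i k) (basis j k) (basis (suc j) k) B (binom (suc j ℕ.+ i) i) (linSum i j j k)
       (linSum i (suc j) (suc j) k) (binom s j) (basis s k) (basis (suc s) k) (binom j (suc j))
       (+ i) (+ j) (+ k))))
  where
  s = suc (j ℕ.+ i)
  B = binom (j ℕ.+ i) i
  alg : ∀ a b b′ x x′ t t′ c d d′ z i j k →
    (+ 1 + j) * (+ 1 + j) * (a * b′)
    ≡ (+ 1 + j) * (+ 1 + j) * (x′ * t′)
      + a * ((+ 1 + j) * (+ 1 + j) * b′ - (k * (+ 1 + k) - j * (+ 1 + j)) * b)
      + (k * (+ 1 + k) - j * (+ 1 + j)) * (a * b - x * t)
      + (- x) * ((+ 1 + j) * (+ 1 + (j + i)) * t′ + (+ 2 + (j + i)) * (+ 2 + (j + i)) * (z * c * d′)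
                 - (k * (+ 1 + k) - j * (+ 1 + j)) * (t + z * c * d))
      + x * ((+ 2 + (j + i)) * (+ 2 + (j + i)) * (c * d′) - (k * (+ 1 + k) - j * (+ 1 + j)) * (c * d)) * (z - + 0)
      + (- ((+ 1 + j) * t′)) * ((+ 1 + (j + i) - i) * x′ - (+ 1 + (j + i)) * x)
  alg = solve-∀

linSum-span : ∀ i j v → Span basis (linSum i j v)
linSum-span i j zero    = scale (linCoeff i j 0) (gen i)
linSum-span i j (suc v) = add (linSum-span i j v) (scale (linCoeff i j (suc v)) (gen (suc v ℕ.+ i)))

basis-*-span : ∀ i j → Span basis (λ k → basis i k * basis j k)
basis-*-span i j = resp (λ k → sym (basis-* i j k)) (scale (binom (j ℕ.+ i) i) (linSum-span i j j))

-- The subring G and squares of integral functions.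

double-good : ∀ {f} → Span basis f → Span goodBasis (λ k → + 2 * f k)
double-good = span-*ˡ (λ _ → + 2) λ
  { 0             → scale (+ 2) (gen 0)
  ; 1             → resp (λ k → cong (+ 2 *_) (*-identityˡ (basis 1 k))) (scale (+ 2) (gen 1))
  ; (suc (suc j)) → gen (suc (suc j)) }

-- The two Pascal summands `C(2i+1,i)` and `C(2i+1,i+1)` are equal.
central-binom : ∀ i → binom (suc i ℕ.+ suc i) (suc i) ≡ + 2 * binom (i ℕ.+ suc i) i
central-binom i = *-cancelˡ-≡ (+ suc i) _ _
  (lin₂ (+ suc i) (+ 1) (pascal (i ℕ.+ suc i) i) (absorb-lower (i ℕ.+ suc i) i)
    (alg (binom (suc i ℕ.+ suc i) (suc i)) (binom (i ℕ.+ suc i) i) (binom (i ℕ.+ suc i) (suc i)) (+ i)))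
  where
  alg : ∀ a b c i → (+ 1 + i) * a ≡ (+ 1 + i) * (+ 2 * b)
    + (+ 1 + i) * (a - (b + c)) + + 1 * ((+ 1 + i) * c - (i + (+ 1 + i) - i) * b)
  alg = solve-∀

-- Half the square of `basis (suc i)`: the leading factor `C(2i+2,i+1)` of its expansion is even.
halfSquare : ℕ → ℕ → ℤ
halfSquare i k = binom (i ℕ.+ suc i) i * linSum (suc i) (suc i) (suc i) k

halfSquare-span : ∀ i → Span basis (halfSquare i)
halfSquare-span i = scale (binom (i ℕ.+ suc i) i) (linSum-span (suc i) (suc i) (suc i))

basis-square : ∀ i k → basis (suc i) k * basis (suc i) k ≡ + 2 * halfSquare i k
basis-square i k = trans (basis-* (suc i) (suc i) k)
  (trans (cong (_* linSum (suc i) (suc i) (suc i) k) (central-binom i))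
         (*-assoc (+ 2) (binom (i ℕ.+ suc i) i) (linSum (suc i) (suc i) (suc i) k)))

-- Apart from products with the constant 1, a weight provides the factor 2 in every case but
-- `basis 1` squared, which is even as a square.
goodBasis-* : ∀ i j → Span goodBasis (λ k → goodBasis i k * goodBasis j k)
goodBasis-* zero          j       = resp (λ k → sym (*-identityˡ (goodBasis j k))) (gen j)
goodBasis-* (suc i)       zero    = resp (λ k → sym (*-identityʳ (goodBasis (suc i) k))) (gen (suc i))
goodBasis-* (suc zero)    (suc zero) = resp
  (λ k → trans (sym (basis-square 0 k)) (alg (basis 1 k))) (double-good (halfSquare-span 0))
  where
  alg : ∀ b → b * b ≡ (+ 1 * b) * (+ 1 * b)
  alg = solve-∀
goodBasis-* (suc zero)    (suc (suc j)) = resp (λ k → alg (basis 1 k) (basis (suc (suc j)) k))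
  (double-good (basis-*-span 1 (suc (suc j))))
  where
  alg : ∀ b c → + 2 * (b * c) ≡ (+ 1 * b) * (+ 2 * c)
  alg = solve-∀
goodBasis-* (suc (suc i)) (suc j) = resp
  (λ k → alg (goodWeight (suc j)) (basis (suc (suc i)) k) (basis (suc j) k))
  (scale (goodWeight (suc j)) (double-good (basis-*-span (suc (suc i)) (suc j))))
  where
  alg : ∀ w b c → w * (+ 2 * (b * c)) ≡ (+ 2 * b) * (w * c)
  alg = solve-∀

-- Squaring is additive modulo doubled products, which lie in G, so only generators matter:
-- `basis 0` squares to 1, the others to even functions.
square-good : ∀ {f} → Span basis f → Span goodBasis (λ k → f k * f k)
square-good (gen zero)    = gen 0
square-good (gen (suc i)) = resp (λ k → sym (basis-square i k)) (double-good (halfSquare-span i))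
square-good (add {f} {f′} p q) = resp (λ k → alg (f k) (f′ k))
  (add (add (square-good p) (square-good q)) (double-good (span-* basis-*-span p q)))
  where
  alg : ∀ x y → x * x + y * y + + 2 * (x * y) ≡ (x + y) * (x + y)
  alg = solve-∀
square-good (scale c {f} p) = resp (λ k → alg c (f k)) (scale (c * c) (square-good p))
  where
  alg : ∀ c x → c * c * (x * x) ≡ (c * x) * (c * x)
  alg = solve-∀
square-good (resp e p) = resp (λ k → cong₂ _*_ (e k) (e k)) (square-good p)

-- Polynomial arithmetic on coefficients.

-- The Cauchy product, shifting the left factor just as `_*ₚ_` takes the tail of its left list.
conv : (ℕ → ℤ) → (ℕ → ℤ) → ℕ → ℤ
conv e f zero    = e 0 * f 0
conv e f (suc j) = e 0 * f (suc j) + conv (e ∘ suc) f j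

conv-cong : ∀ {e e′ f f′} → (∀ i → e i ≡ e′ i) → (∀ i → f i ≡ f′ i) → ∀ j → conv e f j ≡ conv e′ f′ j
conv-cong p q zero    = cong₂ _*_ (p 0) (q 0)
conv-cong p q (suc j) = cong₂ _+_ (cong₂ _*_ (p 0) (q (suc j))) (conv-cong (p ∘ suc) q j)

conv-zeroˡ : ∀ f j → conv (λ _ → + 0) f j ≡ + 0
conv-zeroˡ f zero    = refl
conv-zeroˡ f (suc j) = trans (+-identityˡ _) (conv-zeroˡ f j)

-- The combination `c * e i + e′ i` is the shape of `conv e f ∘ suc`, as met in associativity.
conv-linearˡ : ∀ c e e′ f j → conv (λ i → c * e i + e′ i) f j ≡ c * conv e f j + conv e′ f j
conv-linearˡ c e e′ f zero    = alg c (e 0) (e′ 0) (f 0)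
  where
  alg : ∀ c x y z → (c * x + y) * z ≡ c * (x * z) + y * z
  alg = solve-∀
conv-linearˡ c e e′ f (suc j) = lin₁ (+ 1) (conv-linearˡ c (e ∘ suc) (e′ ∘ suc) f j)
  (alg c (e 0) (e′ 0) (f (suc j)) (conv (λ i → c * e (suc i) + e′ (suc i)) f j)
       (conv (e ∘ suc) f j) (conv (e′ ∘ suc) f j))
  where
  alg : ∀ c x y z r s t → (c * x + y) * z + r
    ≡ c * (x * z + s) + (y * z + t) + + 1 * (r - (c * s + t))
  alg = solve-∀

conv-assoc : ∀ e f g j → conv (conv e f) g j ≡ conv e (conv f g) j
conv-assoc e f g zero    = *-assoc (e 0) (f 0) (g 0)
conv-assoc e f g (suc j) = lin₂ (+ 1) (+ 1)
  (conv-linearˡ (e 0) (f ∘ suc) (conv (e ∘ suc) f) g j) (conv-assoc (e ∘ suc) f g j)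
  (alg (e 0) (f 0) (g (suc j)) (conv (conv e f ∘ suc) g j) (conv (f ∘ suc) g j)
       (conv (conv (e ∘ suc) f) g j) (conv (e ∘ suc) (conv f g) j))
  where
  alg : ∀ x y z r s t u → x * y * z + r
    ≡ x * (y * z + s) + u + + 1 * (r - (x * s + t)) + + 1 * (t - u)
  alg = solve-∀

conv-sucʳ : ∀ e f j → conv e f (suc j) ≡ conv e (f ∘ suc) j + e (suc j) * f 0
conv-sucʳ e f zero    = refl
conv-sucʳ e f (suc j) = trans (cong (_+_ (e 0 * f (suc (suc j)))) (conv-sucʳ (e ∘ suc) f j))
  (sym (+-assoc (e 0 * f (suc (suc j))) _ _))

coeff-+ₚ : ∀ p q j → coeff (p +ₚ q) j ≡ coeff p j + coeff q j
coeff-+ₚ []      q       j       = sym (+-identityˡ (coeff q j))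
coeff-+ₚ (a ∷ p) []      j       = sym (+-identityʳ (coeff (a ∷ p) j))
coeff-+ₚ (a ∷ p) (b ∷ q) zero    = refl
coeff-+ₚ (a ∷ p) (b ∷ q) (suc j) = coeff-+ₚ p q j

coeff-·ₚ : ∀ c p j → coeff (c ·ₚ p) j ≡ c * coeff p j
coeff-·ₚ c []      j       = sym (*-zeroʳ c)
coeff-·ₚ c (a ∷ p) zero    = refl
coeff-·ₚ c (a ∷ p) (suc j) = coeff-·ₚ c p j

coeff-*ₚ : ∀ p q j → coeff (p *ₚ q) j ≡ conv (coeff p) (coeff q) j
coeff-*ₚ []      q j       = sym (conv-zeroˡ (coeff q) j)
coeff-*ₚ (a ∷ p) q zero    = trans (coeff-+ₚ (a ·ₚ q) _ 0)
  (trans (+-identityʳ _) (coeff-·ₚ a q 0))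
coeff-*ₚ (a ∷ p) q (suc j) = trans (coeff-+ₚ (a ·ₚ q) _ (suc j))
  (cong₂ _+_ (coeff-·ₚ a q (suc j)) (coeff-*ₚ p q j))

-- Formulated on coefficients because the lists may differ by trailing zeros.
coeff-^ₚ-+ : ∀ p r s j → coeff (p ^ₚ (r ℕ.+ s)) j ≡ conv (coeff (p ^ₚ r)) (coeff (p ^ₚ s)) j
coeff-^ₚ-+ p zero    s zero    = sym (*-identityˡ (coeff (p ^ₚ s) 0))
coeff-^ₚ-+ p zero    s (suc j) = sym (trans
  (cong₂ _+_ (*-identityˡ (coeff (p ^ₚ s) (suc j))) (conv-zeroˡ (coeff (p ^ₚ s)) j))
  (+-identityʳ _))
coeff-^ₚ-+ p (suc r) s j = trans (coeff-*ₚ p (p ^ₚ (r ℕ.+ s)) j)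
  (trans (conv-cong (λ _ → refl) (coeff-^ₚ-+ p r s) j)
  (trans (sym (conv-assoc (coeff p) (coeff (p ^ₚ r)) (coeff (p ^ₚ s)) j))
         (conv-cong (λ i → sym (coeff-*ₚ p (p ^ₚ r) i)) (λ _ → refl) j)))

-- Families of polynomials with coefficients in a span.

Coeffs : (ℕ → ℕ → ℤ) → (ℕ → ℕ → ℤ) → Set
Coeffs g F = ∀ j → Span g (λ k → F k j)

module Ring (g : ℕ → ℕ → ℤ) (one : Span g (λ _ → + 1))
            (mul : ∀ i j → Span g (λ k → g i k * g j k)) where

  pow : ∀ {f} → Span g f → ∀ a → Span g (λ k → f k ℤ.^ a)
  pow p zero    = one
  pow p (suc a) = span-* mul p (pow p a)

  conv-closed : ∀ {E F} → Coeffs g E → Coeffs g F → Coeffs g (λ k → conv (E k) (F k))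
  conv-closed p q zero    = span-* mul (p 0) (q 0)
  conv-closed p q (suc j) = add (span-* mul (p 0) (q (suc j))) (conv-closed (p ∘ suc) q j)

  ^ₚ-closed : ∀ {P : ℕ → Poly} → Coeffs g (coeff ∘ P) → ∀ m → Coeffs g (λ k → coeff (P k ^ₚ m))
  ^ₚ-closed     p zero    zero    = one
  ^ₚ-closed     p zero    (suc j) = scale (+ 0) one
  ^ₚ-closed {P} p (suc m) j       = resp (λ k → sym (coeff-*ₚ (P k) (P k ^ₚ m) j))
    (conv-closed p (^ₚ-closed p m) j)

module Integral = Ring basis (gen 0) basis-*-span
module Good = Ring goodBasis (gen 0) goodBasis-*

-- The two outermost terms of the convolution agree and form a doubled product; what lies between is
-- the convolution square of the shifted sequence, two degrees lower.
conv-square-good : ∀ {F} → Coeffs basis F → Coeffs goodBasis (λ k → conv (F k) (F k))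
conv-square-good p zero = square-good (p 0)
conv-square-good {F} p (suc zero) = resp (λ k → alg (F k 0) (F k 1))
  (double-good (span-* basis-*-span (p 0) (p 1)))
  where
  alg : ∀ x y → + 2 * (x * y) ≡ x * y + y * x
  alg = solve-∀
conv-square-good {F} p (suc (suc j)) = resp
  (λ k → trans (alg (F k 0) (F k (suc (suc j))) (conv (F k ∘ suc) (F k ∘ suc) j))
    (cong (_+_ (F k 0 * F k (suc (suc j)))) (sym (conv-sucʳ (F k ∘ suc) (F k) j))))
  (add (double-good (span-* basis-*-span (p 0) (p (suc (suc j))))) (conv-square-good (p ∘ suc) j))
  where
  alg : ∀ x y s → + 2 * (x * y) + s ≡ x * y + (s + y * x)
  alg = solve-∀

^ₚ-even-good : ∀ {P : ℕ → Poly} → Coeffs basis (coeff ∘ P) → ∀ r →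
               Coeffs goodBasis (λ k → coeff (P k ^ₚ (r ℕ.+ r)))
^ₚ-even-good {P} p r j = resp (λ k → sym (coeff-^ₚ-+ (P k) r r j))
  (conv-square-good (Integral.^ₚ-closed {P} p r) j)

-- Coefficients of the generalised Delannoy polynomials.

coeff-applyUpTo-< : ∀ (f : ℕ → ℤ) g {n j} → j ℕ.< n → coeff (map f (applyUpTo g n)) j ≡ f (g j)
coeff-applyUpTo-< f g {suc n} {zero}  _         = refl
coeff-applyUpTo-< f g {suc n} {suc j} (s≤s j<n) = coeff-applyUpTo-< f (g ∘ suc) j<n

coeff-applyUpTo-≥ : ∀ (f : ℕ → ℤ) g {n j} → n ℕ.≤ j → coeff (map f (applyUpTo g n)) j ≡ + 0
coeff-applyUpTo-≥ f g {zero}          _         = refl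
coeff-applyUpTo-≥ f g {suc n} {suc j} (s≤s n≤j) = coeff-applyUpTo-≥ f (g ∘ suc) n≤j

pos-^-* : ∀ x y h → + (x ℕ.^ h ℕ.* y ℕ.^ h) ≡ (+ x * + y) ℤ.^ h
pos-^-* x y zero    = refl
pos-^-* x y (suc h) = trans (cong +_ (ℕₚ.[m*n]*[o*p]≡[m*o]*[n*p] x (x ℕ.^ h) y (y ℕ.^ h)))
  (trans (pos-* (x ℕ.* y) _) (cong₂ _*_ (pos-* x y) (pos-^-* x y h)))

coeff-D : ∀ h k j → coeff (D (suc h) k) j ≡ basis j k ℤ.^ suc h
coeff-D h k j with j ℕ.<? suc k
... | yes j<1+k = trans (coeff-applyUpTo-< _ id j<1+k)
  (trans (pos-^-* ((k ℕ.+ j) C (2 ℕ.* j)) ((2 ℕ.* j) C j) (suc h)) (cong (ℤ._^ suc h) entry))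
  where
  entry : binom (k ℕ.+ j) (2 ℕ.* j) * binom (2 ℕ.* j) j ≡ basis j k
  entry rewrite ℕₚ.+-identityʳ j | ℕₚ.+-comm k j = trinomial k j j
-- Past the end of the list `C(k,j) = 0`, and the exponent `suc h` is positive, so the power is 0 as
-- well.
... | no j≮1+k = trans (coeff-applyUpTo-≥ _ id (ℕₚ.≮⇒≥ j≮1+k)) (sym vanish)
  where
  vanish : basis j k ℤ.^ suc h ≡ + 0
  vanish rewrite k>n⇒nCk≡0 {k} {j} (ℕₚ.≮⇒≥ j≮1+k) = refl

D-integral : Coeffs basis (coeff ∘ D 1)
D-integral j = resp (λ k → sym (coeff-D 0 k j)) (Integral.pow (gen j) 1)

-- For `j > 0`, a power with exponent `h+2` contains a square, hence is twice an integral function.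
D-good : ∀ h → Coeffs goodBasis (coeff ∘ D (suc (suc h)))
D-good h zero    = resp (λ k → sym (coeff-D (suc h) k 0)) (Good.pow (gen 0) (suc (suc h)))
D-good h (suc j) = resp
  (λ k → sym (trans (coeff-D (suc h) k (suc j))
    (lin₁ (b k ℤ.^ h) (basis-square j k) (alg (b k) (b k ℤ.^ h) (halfSquare j k)))))
  (double-good (span-* basis-*-span (halfSquare-span j) (Integral.pow (gen (suc j)) h)))
  where
  b = basis (suc j)
  alg : ∀ x y z → x * (x * y) ≡ + 2 * (z * y) + y * (x * x - + 2 * z)
  alg = solve-∀

-- Coefficients of the sum and the final divisibility.

-- Of the `a+1` factors `k(k+1)`, one enters `weight`; the others form a power of `basis 1 k`, which
-- equals `k(k+1)`.
coeff-S : ∀ h m a n j →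
          coeff (S h m (suc a) n) j ≡ altSum (λ k → basis 1 k ℤ.^ a * coeff (D h k ^ₚ m) j) n
coeff-S h m a zero    j = refl
coeff-S h m a (suc n) j = trans
  (coeff-+ₚ (S h m (suc a) n) (c ·ₚ P) j)
  (cong₂ _+_ (coeff-S h m a n j) (trans (coeff-·ₚ c P j)
    (lin₁ (sign (suc n) * coeff P j) factor
      (alg (sign (suc n)) (+ w) (weight (suc n)) (basis 1 (suc n) ℤ.^ a) (coeff P j)))))
  where
  w = (suc n ℕ.^ suc a) ℕ.* (suc (suc n) ℕ.^ suc a) ℕ.* (2 ℕ.* suc n ℕ.+ 1)
  c = sign (suc n) * + w
  P = D h (suc n) ^ₚ m
  basis-one : basis 1 (suc n) ≡ + suc n * + suc (suc n)
  basis-one = cong₂ (λ x y → + x * + y) (nC1≡n (suc n)) (nC1≡n (suc (suc n)))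
  factor : + w ≡ weight (suc n) * basis 1 (suc n) ℤ.^ a
  factor rewrite basis-one = trans (pos-* ((suc n ℕ.^ suc a) ℕ.* (suc (suc n) ℕ.^ suc a)) _)
    (trans (cong (_* + (2 ℕ.* suc n ℕ.+ 1)) (pos-^-* (suc n) (suc (suc n)) (suc a)))
    (trans (cong (λ x → (+ suc n * + suc (suc n)) ℤ.^ suc a * (x + + 1)) (pos-* 2 (suc n)))
    (alg′ (+ suc n) (+ suc (suc n)) ((+ suc n * + suc (suc n)) ℤ.^ a))))
    where
    alg′ : ∀ x y z → x * y * z * (+ 2 * x + + 1) ≡ (+ 2 * x + + 1) * (x * y) * z
    alg′ = solve-∀
  alg : ∀ σ w v b d → σ * w * d ≡ σ * v * (b * d) + σ * d * (w - v * b)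
  alg = solve-∀

good-∣ : ∀ {f} n → Span goodBasis f → modulus (suc n) ∣ altSum f (suc n)
good-∣ {f} n p = subst (modulus (suc n) ∣_) (*-identityˡ (altSum f (suc n)))
  (span-∣ (+ 1) (suc n) (λ j → subst (modulus (suc n) ∣_) (unscale j) (goodBasis-∣ n j)) p)
  where
  unscale : ∀ j → goodWeight j * altSum (basis j) (suc n) ≡ + 1 * altSum (goodBasis j) (suc n)
  unscale j = trans (sym (altSum-* (goodWeight j) (basis j) (suc n)))
                    (sym (*-identityˡ (altSum (goodBasis j) (suc n))))

odd-∣ : ∀ {f} r → Span basis f → modulus (suc (r ℕ.+ r)) ∣ altSum f (suc (r ℕ.+ r))
odd-∣ {f} r p = subst (modulus (suc (r ℕ.+ r)) ∣_) (*-identityˡ (altSum f (suc (r ℕ.+ r))))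
  (span-∣ (+ 1) (suc (r ℕ.+ r)) (odd-basis-∣ r) p)

parity : ∀ n → ∃[ r ] (n ≡ r ℕ.+ r ⊎ n ≡ suc (r ℕ.+ r))
parity zero    = 0 , inj₁ refl
parity (suc n) with parity n
... | r , inj₁ refl = r , inj₂ refl
... | r , inj₂ refl = suc r , inj₁ (cong suc (sym (ℕₚ.+-suc r r)))

modulus-ℕ : ∀ n → modulus n ≡ + (n ℕ.* (n ℕ.+ 1) ℕ.* (n ℕ.+ 2))
modulus-ℕ n rewrite ℕₚ.+-comm n 1 | ℕₚ.+-comm n 2 =
  trans (cong (_* + suc (suc n)) (sym (pos-* n (suc n)))) (sym (pos-* (n ℕ.* suc n) (suc (suc n))))

even⇒2∣ : ∀ {n} r → n ≡ r ℕ.+ r → 2 ℕDiv.∣ n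
even⇒2∣ r n≡r+r = ℕDiv.divides r
  (trans n≡r+r (trans (cong (r ℕ.+_) (sym (ℕₚ.+-identityʳ r))) (ℕₚ.*-comm 2 r)))

term : ℕ → ℕ → ℕ → ℕ → ℕ → ℤ
term h m a j k = basis 1 k ℤ.^ a * coeff (D h k ^ₚ m) j

term-integral : ∀ m a j → Span basis (term 1 m a j)
term-integral m a j = span-* basis-*-span (Integral.pow (gen 1) a) (Integral.^ₚ-closed {D 1} D-integral m j)

basis-one-pow-good : ∀ a → Span goodBasis (λ k → basis 1 k ℤ.^ a)
basis-one-pow-good = Good.pow (resp (λ k → *-identityˡ (basis 1 k)) (gen 1))

term-good : ∀ h m a j → Span goodBasis (term (suc (suc h)) m a j)
term-good h m a j = span-* goodBasis-* (basis-one-pow-good a)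
  (Good.^ₚ-closed {D (suc (suc h))} (D-good h) m j)

term-even-good : ∀ r a j → Span goodBasis (term 1 (r ℕ.+ r) a j)
term-even-good r a j = span-* goodBasis-* (basis-one-pow-good a) (^ₚ-even-good {D 1} D-integral r j)

-- An even exponent `m+1` puts the summands in G, and an odd `n+1` is coprime to `n+3`; otherwise
-- the gcd supplies the factor 2.
delannoy-∣ : ∀ m n a j → modulus (suc n) ∣ + gcd 2 (gcd m (suc n)) * altSum (term 1 (suc m) a j) (suc n)
delannoy-∣ m n a j with parity (suc m) | parity (suc n)
... | r , inj₁ 1+m≡r+r | _ = ∣n⇒∣m*n (+ gcd 2 (gcd m (suc n))) {altSum (term 1 (suc m) a j) (suc n)}
  (good-∣ n (subst (λ m → Span goodBasis (term 1 m a j)) (sym 1+m≡r+r) (term-even-good r a j)))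
... | r , inj₂ _ | s , inj₂ refl = ∣n⇒∣m*n (+ gcd 2 (gcd m (suc n))) {altSum (term 1 (suc m) a j) (suc n)}
  (odd-∣ s (term-integral (suc m) a j))
... | r , inj₂ refl | s , inj₁ 1+n≡s+s
  -- Here `m = r+r` and `n+1 = s+s` are both even, so 2 divides the gcd.
  with gcd-greatest {2} ℕDiv.∣-refl (gcd-greatest (even⇒2∣ r refl) (even⇒2∣ s 1+n≡s+s))
... | ℕDiv.divides q gcd≡q*2 = subst (modulus (suc n) ∣_)
  (trans (sym (*-assoc (+ q) (+ 2) (altSum (term 1 (suc m) a j) (suc n))))
         (cong (_* altSum (term 1 (suc m) a j) (suc n)) (sym (trans (cong +_ gcd≡q*2) (pos-* q 2)))))
  (∣n⇒∣m*n (+ q) {+ 2 * altSum (term 1 (suc m) a j) (suc n)}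
    (span-∣ (+ 2) (suc n) (double-∣ n) (term-integral (suc m) a j)))

theorem2p2 : (h m n a : ℕ) → 1 ≤ h → 1 ≤ m → 1 ≤ n → 1 ≤ a →
    ((1 < h → (j : ℕ) → + (n ℕ.* (n ℕ.+ 1) ℕ.* (n ℕ.+ 2)) Unsigned.∣ coeff (S h m a n) j)
    × ((j : ℕ) → + (n ℕ.* (n ℕ.+ 1) ℕ.* (n ℕ.+ 2)) Unsigned.∣ (+ gcd 2 (gcd (m ∸ 1) n) ℤ.* coeff (S 1 m a n) j)))
theorem2p2 (suc h) (suc m) (suc n) (suc a) _ _ _ _ = powers , delannoy
  where
  powers : 1 < suc h → ∀ j →
    + (suc n ℕ.* (suc n ℕ.+ 1) ℕ.* (suc n ℕ.+ 2)) Unsigned.∣ coeff (S (suc h) (suc m) (suc a) (suc n)) j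
  -- Matching on `h > 1` writes the exponent as `h+2`, the form in which a square splits off.
  powers (s≤s (s≤s {n = h} _)) j = ∣⇒∣ᵤ (subst₂ _∣_ (modulus-ℕ (suc n))
    (sym (coeff-S (suc (suc h)) (suc m) a (suc n) j))
    (good-∣ n (term-good h (suc m) a j)))
  delannoy : ∀ j →
    + (suc n ℕ.* (suc n ℕ.+ 1) ℕ.* (suc n ℕ.+ 2)) Unsigned.∣
    + gcd 2 (gcd m (suc n)) * coeff (S 1 (suc m) (suc a) (suc n)) j
  delannoy j = ∣⇒∣ᵤ (subst₂ _∣_ (modulus-ℕ (suc n))
    (cong (+ gcd 2 (gcd m (suc n)) *_) (sym (coeff-S 1 (suc m) a (suc n) j)))
    (delannoy-∣ m n a j))
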